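{- Let $P$ be a finite thin poset, and let $\phi_0\in C^2(X(P);\mathbb{Z}_2)$ be the cellular 2-cochain sending every 2-cell of the diamond space $X(P)$ to the nontrivial element of $\mathbb{Z}_2$. Then $\phi_0$ is a cocycle, and $P$ is balanced colorable if and only if the class $[\phi_0]$ is trivial in $H^2(X(P);\mathbb{Z}_2)$.
   Context: All posets are finite. A graded poset (with rank function $\mathrm{rk}$ satisfying $\mathrm{rk}(y)=\mathrm{rk}(x)+1$ for covers $x\lessdot y$) is thin if every nonempty closed interval of length 2 has exactly 4 elements; these intervals are called diamonds. The diamond space $X(P)$ is the 2-dimensional regular CW complex with 0-cells the elements of $P$, a 1-cell for each cover relation $x\lessdot y$ joining $x$ and $y$, and a 2-cell glued along the boundary 4-cycle of each diamond. Cohomology is cellular cohomology with $\mathbb{Z}_2$ coefficients. Let $C(P)$ be the set of cover relations of $P$. A balanced coloring of $P$ is a function $c:C(P)\to\{1,-1\}$ such that each diamond has an odd number of edges colored $-1$ (equivalently the product of $c$ over the four edges of each diamond is $-1$); $P$ is balanced colorable if it admits one. -}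

module Defs where

open import Data.Nat using (ℕ; suc; _+_)
open import Data.Fin using (Fin; _≟_)
open import Data.Fin.Properties using (any?)
open import Data.Bool using (Bool; true; false; T; _xor_; _∧_)
open import Data.Sign using (Sign) renaming (_*_ to _·_)
open import Data.List using (List; []; _∷_; foldr; map; length; filter; concatMap)
open import Data.Empty using (⊥; ⊥-elim)
open import Data.Product using (Σ; ∃; _×_; _,_; proj₁; proj₂)
open import Relation.Nullary using (¬_; Dec; yes; no; ⌊_⌋)
open import Relation.Nullary.Decidable using (_×-dec_; ¬?; fromWitness)
open import Relation.Binary.Structures using (IsDecPartialOrder)
open import Relation.Binary.PropositionalEquality using (_≡_)

open import Data.List using (allFin) public

-- A finite poset, presented (up to isomorphism) on the carrier Fin n,
-- with a decidable partial order.
record FinitePoset : Set₁ where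
  field
    n    : ℕ
    _≤_  : Fin n → Fin n → Set
    isDecPartialOrder : IsDecPartialOrder _≡_ _≤_

  open IsDecPartialOrder isDecPartialOrder public using () renaming (_≤?_ to _≤?_)

  -- strict order
  _<_ : Fin n → Fin n → Set
  x < y = x ≤ y × ¬ (x ≡ y)

  _<?_ : ∀ x y → Dec (x < y)
  x <? y = (x ≤? y) ×-dec ¬? (x ≟ y)

  -- cover relation x ⋖ y : x < y and nothing strictly between
  _⋖_ : Fin n → Fin n → Set
  x ⋖ y = x < y × ¬ (∃ λ z → x < z × z < y)

  _⋖?_ : ∀ x y → Dec (x ⋖ y)
  x ⋖? y = (x <? y) ×-dec ¬? (any? (λ z → (x <? z) ×-dec (z <? y)))

  -- Boolean versions (proof-irrelevant, used to index cells)
  isCover : Fin n → Fin n → Bool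
  isCover x y = ⌊ x ⋖? y ⌋

  -- number of elements of the closed interval [x, y]
  intervalSize : Fin n → Fin n → ℕ
  intervalSize x y = length (filter (λ z → (x ≤? z) ×-dec (z ≤? y)) (allFin n))

open FinitePoset public using (n; intervalSize; isCover)

module _ (P : FinitePoset) where
  private
    N = n P

  -- rk is a rank function: covers increase rank by exactly one
  IsRankFunction : (Fin N → ℕ) → Set
  IsRankFunction rk = ∀ x y → FinitePoset._⋖_ P x y → rk y ≡ suc (rk x)

  -- thin: every nonempty closed interval of length 2 has exactly 4 elements
  IsThin : (Fin N → ℕ) → Set
  IsThin rk = ∀ x y → FinitePoset._≤_ P x y → rk y ≡ 2 + rk x →
              intervalSize P x y ≡ 4

module DiamondSpace (P : FinitePoset) (rk : Fin (n P) → ℕ) where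
  private
    N = n P
    open FinitePoset P using (_≤?_; _⋖?_)

  -- cells of X(P)
  Cell₀ : Set
  Cell₀ = Fin N

  -- 1-cells: cover relations x ⋖ y
  Cell₁ : Set
  Cell₁ = Σ (Fin N × Fin N) λ p → T (isCover P (proj₁ p) (proj₂ p))

  open import Data.Nat using (_≡ᵇ_)

  -- 2-cells: diamonds, i.e. nonempty closed intervals [x, y] of length 2
  Cell₂ : Set
  Cell₂ = Σ (Fin N × Fin N) λ p →
            T (⌊ proj₁ p ≤? proj₂ p ⌋ ∧ (rk (proj₂ p) ≡ᵇ (2 + rk (proj₁ p))))

  -- X(P) is 2-dimensional: there are no 3-cells
  Cell₃ : Set
  Cell₃ = ⊥

  -- boundary 4-cycle of a diamond [x, y]: the edges x ⋖ z and z ⋖ y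
  -- for the (two) middle elements z
  boundary₂ : Cell₂ → List Cell₁
  boundary₂ ((x , y) , _) = concatMap edgesVia (allFin N)
    where
      edgesVia : Fin N → List Cell₁
      edgesVia z with x ⋖? z | z ⋖? y
      ... | yes p | yes q = ((x , z) , fromWitness p) ∷ ((z , y) , fromWitness q) ∷ []
      ... | _     | _     = []

  boundary₃ : Cell₃ → List Cell₂
  boundary₃ ()

  -- cellular cochains with ℤ₂ = Bool (xor as addition, false as zero)
  C¹ C² C³ : Set
  C¹ = Cell₁ → Bool
  C² = Cell₂ → Bool
  C³ = Cell₃ → Bool

  sum₂ : List Bool → Bool
  sum₂ = foldr _xor_ false

  -- cellular coboundaries (all incidence numbers are 1 mod 2 in a regular CW complex)
  δ¹ : C¹ → C²
  δ¹ ψ d = sum₂ (map ψ (boundary₂ d))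

  δ² : C² → C³
  δ² φ t = sum₂ (map φ (boundary₃ t))

  IsCocycle₂ : C² → Set
  IsCocycle₂ φ = ∀ t → δ² φ t ≡ false

  -- the class [φ] is trivial in H²(X(P); ℤ₂) : φ is a coboundary
  IsCohomologouslyTrivial₂ : C² → Set
  IsCohomologouslyTrivial₂ φ = ∃ λ (ψ : C¹) → ∀ d → δ¹ ψ d ≡ φ d

  -- φ₀ sends every 2-cell to the nontrivial element of ℤ₂
  φ₀ : C²
  φ₀ _ = true

  -- balanced colorings c : C(P) → {1, -1} (Sign.+ / Sign.-): the product
  -- over the four edges of each diamond is -1
  IsBalancedColoring : (Cell₁ → Sign) → Set
  IsBalancedColoring c = ∀ d → foldr _·_ Sign.+ (map c (boundary₂ d)) ≡ Sign.-

  BalancedColorable : Set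
  BalancedColorable = ∃ IsBalancedColoring

module Submission where

-- Proof idea.  The sign group ({+1,-1}, ·) and ℤ₂ = (Bool, xor) are
-- isomorphic via  + ↦ false,  - ↦ true.  Under this isomorphism a
-- coloring c : C(P) → {±1} becomes a 1-cochain ψ = toℤ₂ ∘ c, and the
-- product of c around the boundary of a diamond d becomes the ℤ₂-sum
-- of ψ over that boundary, i.e. (δ¹ ψ)(d).  Hence "every diamond
-- product is -1" says exactly "δ¹ ψ = φ₀", and conversely a cochain ψ
-- with δ¹ ψ = φ₀ yields the balanced coloring fromℤ₂ ∘ ψ.  That φ₀ is
-- a cocycle is immediate: X(P) is 2-dimensional, so there are no
-- 3-cells and δ² vanishes on every cochain.

open import Defs
open import Data.Nat using (ℕ)
open import Data.Fin using (Fin)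
open import Data.Bool using (Bool; true; false; _xor_)
open import Data.Sign using (Sign) renaming (_*_ to _·_)
open import Data.List using (List; foldr; map)
open import Data.List.Properties using (foldr-fusion; foldr-map; map-∘; map-cong)
open import Data.Product using (_×_; _,_)
open import Function using (_∘_)
open import Function.Bundles using (_⇔_; mk⇔)
open import Relation.Binary.PropositionalEquality
  using (_≡_; refl; sym; trans; cong; module ≡-Reasoning)

-- The isomorphism between the sign group and ℤ₂ and its inverse.
toℤ₂ : Sign → Bool
toℤ₂ Sign.+ = false
toℤ₂ Sign.- = true

fromℤ₂ : Bool → Sign
fromℤ₂ false = Sign.+
fromℤ₂ true  = Sign.-

toℤ₂∘fromℤ₂ : ∀ b → toℤ₂ (fromℤ₂ b) ≡ b
toℤ₂∘fromℤ₂ false = refl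
toℤ₂∘fromℤ₂ true  = refl

-- toℤ₂ is a group homomorphism: multiplication of signs becomes xor.
toℤ₂-· : ∀ s t → toℤ₂ (s · t) ≡ toℤ₂ s xor toℤ₂ t
toℤ₂-· Sign.+ t      = refl
toℤ₂-· Sign.- Sign.+ = refl
toℤ₂-· Sign.- Sign.- = refl

-- toℤ₂ detects -1: a sign whose image is the nontrivial element is -1.
toℤ₂-reflects-minus : ∀ {s} → toℤ₂ s ≡ true → s ≡ Sign.-
toℤ₂-reflects-minus {Sign.-} _ = refl

-- Being a homomorphism, toℤ₂ sends the product of a list of signs to
-- the ℤ₂-sum of their images.
toℤ₂-product : ∀ (ss : List Sign) →
  toℤ₂ (foldr _·_ Sign.+ ss) ≡ foldr _xor_ false (map toℤ₂ ss)
toℤ₂-product ss = trans (foldr-fusion toℤ₂ Sign.+ toℤ₂-· ss)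
                        (sym (foldr-map _xor_ toℤ₂ false ss))

module _ (P : FinitePoset) (rk : Fin (n P) → ℕ) where
  open DiamondSpace P rk

  -- The coboundary of the ℤ₂-image of a coloring c, evaluated on a
  -- diamond d, is the ℤ₂-image of the product of c around d.
  δ¹-of-coloring : ∀ (c : Cell₁ → Sign) d →
    δ¹ (toℤ₂ ∘ c) d ≡ toℤ₂ (foldr _·_ Sign.+ (map c (boundary₂ d)))
  δ¹-of-coloring c d = begin
    sum₂ (map (toℤ₂ ∘ c) (boundary₂ d))        ≡⟨ cong sum₂ (map-∘ (boundary₂ d)) ⟩
    sum₂ (map toℤ₂ (map c (boundary₂ d)))       ≡⟨ sym (toℤ₂-product (map c (boundary₂ d))) ⟩
    toℤ₂ (foldr _·_ Sign.+ (map c (boundary₂ d))) ∎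
    where open ≡-Reasoning

  -- A balanced coloring, read in ℤ₂, is a 1-cochain with coboundary φ₀.
  balanced⇒trivial : BalancedColorable → IsCohomologouslyTrivial₂ φ₀
  balanced⇒trivial (c , balanced) =
    toℤ₂ ∘ c , λ d → trans (δ¹-of-coloring c d) (cong toℤ₂ (balanced d))

  -- A 1-cochain with coboundary φ₀, read as signs, is a balanced coloring.
  trivial⇒balanced : IsCohomologouslyTrivial₂ φ₀ → BalancedColorable
  trivial⇒balanced (ψ , δψ≡φ₀) = fromℤ₂ ∘ ψ , λ d →
    toℤ₂-reflects-minus (begin
      toℤ₂ (foldr _·_ Sign.+ (map (fromℤ₂ ∘ ψ) (boundary₂ d))) ≡⟨ sym (δ¹-of-coloring (fromℤ₂ ∘ ψ) d) ⟩
      δ¹ (toℤ₂ ∘ fromℤ₂ ∘ ψ) d                                ≡⟨ cong sum₂ (map-cong (toℤ₂∘fromℤ₂ ∘ ψ) (boundary₂ d)) ⟩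
      δ¹ ψ d                                                   ≡⟨ δψ≡φ₀ d ⟩
      true                                                     ∎)
    where open ≡-Reasoning

mainTheorem3 : (P : FinitePoset) (rk : Fin (n P) → ℕ) →
    IsRankFunction P rk → IsThin P rk →
    let open DiamondSpace P rk in
    IsCocycle₂ φ₀ × (BalancedColorable ⇔ IsCohomologouslyTrivial₂ φ₀)
mainTheorem3 P rk _ _ =
  -- X(P) has no 3-cells, so every 2-cochain, in particular φ₀, is a cocycle
  (λ ()) ,
  mk⇔ (balanced⇒trivial P rk) (trivial⇒balanced P rk)
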